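{- Let $G\cong C_{n_1}\oplus\cdots\oplus C_{n_r}$ with $1<n_1\mid n_2\mid\cdots\mid n_r$ be a finite abelian group of rank $r\geq 2$, and let $k$ be an integer with $\exp(G)\leq \mathsf{D}^*(G)-k\leq 2\exp(G)-1$. Then $\mathsf{s}_{\leq \mathsf{D}^*(G)-k}(G)\geq \mathsf{D}^*(G)+k$. In particular, if $G$ is a finite abelian $p$-group with $r(G)\geq 2$ and $\mathsf{D}(G)\leq 2\exp(G)-1$, then $\mathsf{s}_{\leq \mathsf{D}(G)-k}(G)\geq \mathsf{D}(G)+k$ for every integer $k$ with $\exp(G)\leq \mathsf{D}(G)-k\leq \mathsf{D}(G)$.
   Context: All groups are finite abelian, written additively. For $G\cong C_{n_1}\oplus\cdots\oplus C_{n_r}$ with $1<n_1\mid\cdots\mid n_r$, $r(G)=r$ is the rank and $\exp(G)=n_r$ the exponent, and $\mathsf{D}^*(G)=1+\sum_{i=1}^r(n_i-1)$. A sequence over $G$ is a finite unordered sequence (multiset) of elements of $G$; length counts multiplicity; a zero-sum sequence has sum $0$. $\mathsf{D}(G)$ (Davenport constant) is the smallest $t$ such that every sequence over $G$ of length at least $t$ has a nonempty zero-sum subsequence. For $k\in\mathbb{N}$, $\mathsf{s}_{\leq k}(G)$ denotes the smallest $\ell\in\mathbb{N}\cup\{+\infty\}$ such that every sequence over $G$ of length $\ell$ has a nonempty zero-sum subsequence of length at most $k$. -}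

module Defs where

open import Data.Nat using (ℕ; suc; _+_; _∸_; _≤_)
open import Data.Nat.Divisibility using (_∣_)
open import Data.Fin using (Fin; toℕ)
open import Data.List using (List; []; length; map; allFin)
open import Data.Nat.ListAction using (sum)
open import Data.List.Relation.Binary.Sublist.Propositional using (_⊆_)
open import Data.Product using (Σ; _×_)
open import Relation.Nullary using (¬_)
open import Relation.Binary.PropositionalEquality using (_≡_)

Elt : {r : ℕ} → (Fin r → ℕ) → Set
Elt {r} n = (i : Fin r) → Fin (n i)

-- A sequence over G (unordered; represented by a list, order irrelevant).
Seq : {r : ℕ} → (Fin r → ℕ) → Set
Seq n = List (Elt n)

ZeroSum : {r : ℕ} → (n : Fin r → ℕ) → Seq n → Set
ZeroSum {r} n S = (i : Fin r) → n i ∣ sum (map (λ g → toℕ (g i)) S)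

Dstar : {r : ℕ} → (Fin r → ℕ) → ℕ
Dstar {r} n = 1 + sum (map (λ i → n i ∸ 1) (allFin r))

HasShortZS : {r : ℕ} → (n : Fin r → ℕ) → ℕ → Seq n → Set
HasShortZS n m S =
  Σ (Seq n) λ T → T ⊆ S × ¬ (T ≡ []) × length T ≤ m × ZeroSum n T

-- every sequence of length ℓ has a nonempty zero-sum subsequence of length ≤ m
-- (s_{≤m}(G) is the least such ℓ in ℕ ∪ {∞})
SProp : {r : ℕ} → (n : Fin r → ℕ) → ℕ → ℕ → Set
SProp n m ℓ = (S : Seq n) → length S ≡ ℓ → HasShortZS n m S

-- s_{≤m}(G) ≥ N  (as an element of ℕ ∪ {∞}): every ℓ with the property is ≥ N
s≤-atLeast : {r : ℕ} → (n : Fin r → ℕ) → ℕ → ℕ → Set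
s≤-atLeast n m N = (ℓ : ℕ) → SProp n m ℓ → N ≤ ℓ

{-# OPTIONS --safe #-}
-- Let M = n (fromℕ r) = exp(G), let e_i be the unit vectors, and put m = D*(G) − k, so m < 2M.
-- The sequence
--   e_last^(2M − 1 − m) · ∏_{i ≠ last} e_i^(n_i − 1) (e_last − e_i)^(n_i − 1)
-- has length 2D*(G) − m − 1. Let a zero-sum subsequence contain b terms e_last and E_i, F_i terms
-- e_i, e_last − e_i. Coordinate i gives n_i ∣ E_i − F_i, so E_i = F_i as both are below n_i, and
-- the last coordinate gives M ∣ b + ΣF_i. If the subsequence is nonempty then b + ΣF_i ≥ M, so its
-- length is b + 2ΣF_i = 2(b + ΣF_i) − b ≥ 2M − (2M − 1 − m) = m + 1. Hence
-- s_{≤m}(G) ≥ 2D*(G) − m = D*(G) + k.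
module Submission where

open import Defs

-- ℕ's _+_ is opened only inside this module, so that _+_ in mainTheorem2 below is ℤ's.
module _ where

  open import Data.Nat
    using (ℕ; zero; suc; _+_; _*_; _∸_; _≤_; _<_; _%_; z<s; s≤s; NonZero; ≢-nonZero; >-nonZero⁻¹)
  open import Data.Nat.Properties
  open import Data.Nat.DivMod
    using (_mod_; %-distribˡ-+; m%n%n≡m%n; [m+kn]%n≡m%n; m≤n⇒m%n≡m; %-remove-+ˡ)
  open import Data.Nat.Divisibility using (_∣_; m%n≡0⇒n∣m; n∣m⇒m%n≡0; ∣⇒≤)
  open import Data.Nat.ListAction using (sum)
  open import Data.Nat.ListAction.Properties using (sum-++)
  open import Data.Nat.Tactic.RingSolver using (solve-∀)
  open import Data.Fin using (Fin; zero; suc; toℕ; fromℕ; inject₁)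
  open import Data.Fin.Properties using (toℕ-fromℕ<)
  open import Data.List using (List; []; _∷_; _++_; length; map; replicate; take; tabulate; allFin)
  open import Data.List.Properties
    using (map-∘; map-cong; map-++; map-tabulate; length-++; length-map; length-replicate; length-take)
  open import Data.List.Relation.Binary.Sublist.Propositional using (_⊆_; []; _∷_; _∷ʳ_; ⊆-trans)
  open import Data.List.Relation.Binary.Sublist.Propositional.Properties using (take-⊆)
  open import Data.Vec.Functional using (Vector) renaming (_∷_ to _◂_)
  open import Data.Product using (∃; ∃₂; _×_; _,_; proj₁; proj₂)
  open import Function using (_∘_; id; const)
  open import Relation.Nullary using (¬_; contradiction)
  open import Relation.Binary.PropositionalEquality

  private variable
    A B : Set
    r : ℕ

  ⊆-++⁻ : ∀ {xs : List A} ys {zs} → xs ⊆ ys ++ zs →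
          ∃₂ λ ys′ zs′ → ys′ ⊆ ys × zs′ ⊆ zs × xs ≡ ys′ ++ zs′
  ⊆-++⁻ [] p = [] , _ , [] , p , refl
  ⊆-++⁻ (y ∷ ys) (.y ∷ʳ p) with ⊆-++⁻ ys p
  ... | ys′ , zs′ , p₁ , p₂ , refl = ys′ , zs′ , y ∷ʳ p₁ , p₂ , refl
  ⊆-++⁻ (y ∷ ys) (refl ∷ p) with ⊆-++⁻ ys p
  ... | ys′ , zs′ , p₁ , p₂ , refl = y ∷ ys′ , zs′ , refl ∷ p₁ , p₂ , refl

  ⊆-replicate⁻ : ∀ {xs : List A} k {x} → xs ⊆ replicate k x →
                 ∃ λ j → j ≤ k × xs ≡ replicate j x
  ⊆-replicate⁻ zero [] = 0 , ≤-refl , refl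
  ⊆-replicate⁻ (suc k) (_ ∷ʳ p) with ⊆-replicate⁻ k p
  ... | j , j≤k , refl = j , m≤n⇒m≤1+n j≤k , refl
  ⊆-replicate⁻ (suc k) (refl ∷ p) with ⊆-replicate⁻ k p
  ... | j , j≤k , refl = suc j , s≤s j≤k , refl

  ⊆-map⁻ : ∀ (f : A → B) {xs} ys → xs ⊆ map f ys → ∃ λ zs → zs ⊆ ys × xs ≡ map f zs
  ⊆-map⁻ f [] [] = [] , [] , refl
  ⊆-map⁻ f (y ∷ ys) (_ ∷ʳ p) with ⊆-map⁻ f ys p
  ... | zs , q , refl = zs , y ∷ʳ q , refl
  ⊆-map⁻ f (y ∷ ys) (refl ∷ p) with ⊆-map⁻ f ys p
  ... | zs , q , refl = y ∷ zs , refl ∷ q , refl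

  ≢[]⇒0<length : {xs : List A} → ¬ xs ≡ [] → 0 < length xs
  ≢[]⇒0<length {xs = []} xs≢[] = contradiction refl xs≢[]
  ≢[]⇒0<length {xs = _ ∷ _} _ = z<s

  [1+n]∣m+o*n⇒m≡o : ∀ n {m o} → m ≤ n → o ≤ n → suc n ∣ m + o * n → m ≡ o
  [1+n]∣m+o*n⇒m≡o n {m} {o} m≤n o≤n 1+n∣ = begin
    m                       ≡⟨ m≤n⇒m%n≡m m≤n ⟨
    m % suc n               ≡⟨ [m+kn]%n≡m%n m o (suc n) ⟨
    (m + o * suc n) % suc n ≡⟨ cong (_% suc n) (rearrange m o n) ⟩
    (m + o * n + o) % suc n ≡⟨ %-remove-+ˡ o 1+n∣ ⟩
    o % suc n               ≡⟨ m≤n⇒m%n≡m o≤n ⟩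
    o                       ∎
    where
    open ≡-Reasoning
    rearrange : ∀ m o n → m + o * suc n ≡ m + o * n + o
    rearrange = solve-∀

  sum-map-% : ∀ d .{{_ : NonZero d}} (xs : List ℕ) → sum (map (_% d) xs) % d ≡ sum xs % d
  sum-map-% d [] = refl
  sum-map-% d (x ∷ xs) = begin
    (x % d + sum (map (_% d) xs)) % d         ≡⟨ %-distribˡ-+ (x % d) _ d ⟩
    (x % d % d + sum (map (_% d) xs) % d) % d ≡⟨ cong₂ (λ u w → (u + w) % d)
                                                        (m%n%n≡m%n x d) (sum-map-% d xs) ⟩
    (x % d + sum xs % d) % d                  ≡⟨ %-distribˡ-+ x (sum xs) d ⟨
    (x + sum xs) % d                          ∎
    where open ≡-Reasoning

  ∣sum-map-%⇒∣sum : ∀ d .{{_ : NonZero d}} (xs : List ℕ) → d ∣ sum (map (_% d) xs) → d ∣ sum xs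
  ∣sum-map-%⇒∣sum d xs d∣ =
    m%n≡0⇒n∣m (sum xs) d (trans (sym (sum-map-% d xs)) (n∣m⇒m%n≡0 _ d d∣))

  coordSum : List (Vector ℕ r) → Fin r → ℕ
  coordSum vs i = sum (map (λ v → v i) vs)

  coordSum-++ : ∀ (vs ws : List (Vector ℕ r)) i →
                coordSum (vs ++ ws) i ≡ coordSum vs i + coordSum ws i
  coordSum-++ vs ws i = trans (cong sum (map-++ (λ v → v i) vs ws)) (sum-++ (map _ vs) (map _ ws))

  coordSum-replicate : ∀ k (v : Vector ℕ r) i → coordSum (replicate k v) i ≡ k * v i
  coordSum-replicate zero v i = refl
  coordSum-replicate (suc k) v i = cong (v i +_) (coordSum-replicate k v i)

  coordSum-◂-zero : ∀ x (vs : List (Vector ℕ r)) → coordSum (map (x ◂_) vs) zero ≡ length vs * x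
  coordSum-◂-zero x [] = refl
  coordSum-◂-zero x (v ∷ vs) = cong (x +_) (coordSum-◂-zero x vs)

  coordSum-◂-suc : ∀ x (vs : List (Vector ℕ r)) i →
                   coordSum (map (x ◂_) vs) (suc i) ≡ coordSum vs i
  coordSum-◂-suc x [] i = refl
  coordSum-◂-suc x (v ∷ vs) i = cong (v i +_) (coordSum-◂-suc x vs i)

  reduce : (n : Fin r → ℕ) → (∀ i → NonZero (n i)) → Vector ℕ r → Elt n
  reduce n nz v i = _mod_ (v i) (n i) {{nz i}}

  ZeroSum-reduce⇒∣coordSum : ∀ (n : Fin r → ℕ) nz vs → ZeroSum n (map (reduce n nz) vs) →
                             ∀ i → n i ∣ coordSum vs i
  ZeroSum-reduce⇒∣coordSum n nz vs zs i =
    ∣sum-map-%⇒∣sum (n i) (map (λ v → v i) vs) (subst (n i ∣_) (cong sum coordinates) (zs i))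
    where
    instance
      nzᵢ : NonZero (n i)
      nzᵢ = nz i
    coordinates : map (λ g → toℕ (g i)) (map (reduce n nz) vs) ≡ map (_% n i) (map (λ v → v i) vs)
    coordinates = begin
      map (λ g → toℕ (g i)) (map (reduce n nz) vs) ≡⟨ map-∘ vs ⟨
      map (λ v → toℕ (reduce n nz v i)) vs          ≡⟨ map-cong (λ v → toℕ-fromℕ< _) vs ⟩
      map (λ v → v i % n i) vs                      ≡⟨ map-∘ vs ⟩
      map (_% n i) (map (λ v → v i) vs)             ∎
      where open ≡-Reasoning

  lastUnit : ∀ R → Vector ℕ (suc R)
  lastUnit zero = 1 ◂ const 0
  lastUnit (suc R) = 0 ◂ lastUnit R

  lastUnit-fromℕ : ∀ R → lastUnit R (fromℕ R) ≡ 1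
  lastUnit-fromℕ zero = refl
  lastUnit-fromℕ (suc R) = lastUnit-fromℕ R

  lastUnit-inject₁ : ∀ R (j : Fin R) → lastUnit R (inject₁ j) ≡ 0
  lastUnit-inject₁ (suc R) zero = refl
  lastUnit-inject₁ (suc R) (suc j) = lastUnit-inject₁ R j

  -- For μ = n₀ − 1, the vector μ ◂ lastUnit R is e_last − e₀.
  pairBlock : ∀ R → ℕ → List (Vector ℕ (suc (suc R)))
  pairBlock R μ = replicate μ (1 ◂ const 0) ++ replicate μ (μ ◂ lastUnit R)

  ⊆pairBlock-balanced : ∀ R μ {T} → T ⊆ pairBlock R μ → suc μ ∣ coordSum T zero →
                        length T ≡ 2 * coordSum T (suc (fromℕ R)) ×
                        (∀ j → coordSum T (suc (inject₁ j)) ≡ 0)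
  ⊆pairBlock-balanced R μ T⊆ ∣cs₀ with ⊆-++⁻ (replicate μ _) T⊆
  ... | T₁ , T₂ , T₁⊆ , T₂⊆ , refl with ⊆-replicate⁻ μ T₁⊆ | ⊆-replicate⁻ μ T₂⊆
  ... | a , a≤μ , refl | b , b≤μ , refl = length≡ , cs-inner
    where
    e = 1 ◂ const 0
    f = μ ◂ lastUnit R
    T = replicate a e ++ replicate b f
    cs : ∀ i → coordSum T i ≡ a * e i + b * f i
    cs i = trans (coordSum-++ (replicate a e) _ i)
                 (cong₂ _+_ (coordSum-replicate a e i) (coordSum-replicate b f i))
    a≡b : a ≡ b
    a≡b = [1+n]∣m+o*n⇒m≡o μ a≤μ b≤μ
            (subst (suc μ ∣_) (trans (cs zero) (cong (_+ b * μ) (*-identityʳ a))) ∣cs₀)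
    cs-last : coordSum T (suc (fromℕ R)) ≡ b
    cs-last = trans (cs (suc (fromℕ R)))
                    (cong₂ _+_ (*-zeroʳ a) (trans (cong (b *_) (lastUnit-fromℕ R)) (*-identityʳ b)))
    cs-inner : ∀ j → coordSum T (suc (inject₁ j)) ≡ 0
    cs-inner j = trans (cs (suc (inject₁ j)))
                       (cong₂ _+_ (*-zeroʳ a) (trans (cong (b *_) (lastUnit-inject₁ R j)) (*-zeroʳ b)))
    length≡ : length T ≡ 2 * coordSum T (suc (fromℕ R))
    length≡ = begin
      length T                                        ≡⟨ length-++ (replicate a e) ⟩
      length (replicate a e) + length (replicate b f) ≡⟨ cong₂ _+_ (length-replicate a)
                                                                   (length-replicate b) ⟩
      a + b                                           ≡⟨ cong₂ _+_ a≡b (sym (+-identityʳ b)) ⟩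
      2 * b                                           ≡⟨ cong (2 *_) cs-last ⟨
      2 * coordSum T (suc (fromℕ R))                  ∎
      where open ≡-Reasoning

  unitPairs : ∀ R → (Fin (suc R) → ℕ) → List (Vector ℕ (suc R))
  unitPairs zero n = []
  unitPairs (suc R) n = pairBlock R (n zero ∸ 1) ++ map (0 ◂_) (unitPairs R (n ∘ suc))

  suc[n∸1]≡n : ∀ n .{{_ : NonZero n}} → suc (n ∸ 1) ≡ n
  suc[n∸1]≡n n = m+[n∸m]≡n (>-nonZero⁻¹ n)

  ⊆unitPairs-balanced : ∀ R (n : Fin (suc R) → ℕ) → (∀ i → NonZero (n i)) →
                        ∀ {T} → T ⊆ unitPairs R n →
                        (∀ j → n (inject₁ j) ∣ coordSum T (inject₁ j)) →
                        length T ≡ 2 * coordSum T (fromℕ R)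
  ⊆unitPairs-balanced zero n nz [] _ = refl
  ⊆unitPairs-balanced (suc R) n nz T⊆ ∣cs with ⊆-++⁻ (pairBlock R (n zero ∸ 1)) T⊆
  ... | T₁ , T₂ , T₁⊆ , T₂⊆ , refl with ⊆-map⁻ (0 ◂_) (unitPairs R (n ∘ suc)) T₂⊆
  ... | U , U⊆ , refl = begin
      length (T₁ ++ map (0 ◂_) U)              ≡⟨ length-++ T₁ ⟩
      length T₁ + length (map (0 ◂_) U)        ≡⟨ cong₂ _+_ length-T₁ (trans (length-map _ U) length-U) ⟩
      2 * last₁ + 2 * coordSum U (fromℕ R)     ≡⟨ *-distribˡ-+ 2 last₁ _ ⟨
      2 * (last₁ + coordSum U (fromℕ R))       ≡⟨ cong (2 *_) (cs-suc (fromℕ R)) ⟨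
      2 * coordSum T (suc (fromℕ R))           ∎
    where
    open ≡-Reasoning
    T = T₁ ++ map (0 ◂_) U
    last₁ = coordSum T₁ (suc (fromℕ R))
    cs-suc : ∀ i → coordSum T (suc i) ≡ coordSum T₁ (suc i) + coordSum U i
    cs-suc i = trans (coordSum-++ T₁ _ (suc i)) (cong (coordSum T₁ (suc i) +_) (coordSum-◂-suc 0 U i))
    cs-zero : coordSum T zero ≡ coordSum T₁ zero
    cs-zero = begin
      coordSum T zero                                 ≡⟨ coordSum-++ T₁ _ zero ⟩
      coordSum T₁ zero + coordSum (map (0 ◂_) U) zero ≡⟨ cong (coordSum T₁ zero +_) (coordSum-◂-zero 0 U) ⟩
      coordSum T₁ zero + length U * 0                 ≡⟨ cong (coordSum T₁ zero +_) (*-zeroʳ (length U)) ⟩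
      coordSum T₁ zero + 0                            ≡⟨ +-identityʳ _ ⟩
      coordSum T₁ zero                                ∎
    block = ⊆pairBlock-balanced R (n zero ∸ 1) T₁⊆
              (subst₂ _∣_ (sym (suc[n∸1]≡n (n zero) {{nz zero}})) cs-zero (∣cs zero))
    length-T₁ = proj₁ block
    length-U : length U ≡ 2 * coordSum U (fromℕ R)
    length-U = ⊆unitPairs-balanced R (n ∘ suc) (nz ∘ suc) U⊆ λ j →
      subst (n (suc (inject₁ j)) ∣_)
            (trans (cs-suc (inject₁ j)) (cong (_+ coordSum U (inject₁ j)) (proj₂ block j)))
            (∣cs (suc j))

  Dstar-suc : ∀ {R} (n : Fin (suc (suc R)) → ℕ) → Dstar n ≡ (n zero ∸ 1) + Dstar (n ∘ suc)
  Dstar-suc {R} n = begin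
    1 + (d zero + sum (map d (tabulate suc)))           ≡⟨ cong (λ ds → 1 + (d zero + sum ds)) shift ⟩
    1 + (d zero + sum (map (d ∘ suc) (allFin (suc R)))) ≡⟨ +-suc (d zero) _ ⟨
    d zero + Dstar (n ∘ suc)                            ∎
    where
    open ≡-Reasoning
    d : Fin (suc (suc R)) → ℕ
    d i = n i ∸ 1
    shift : map d (tabulate suc) ≡ map (d ∘ suc) (allFin (suc R))
    shift = trans (map-tabulate suc d) (sym (map-tabulate id (d ∘ suc)))

  length-pairBlock : ∀ R μ → length (pairBlock R μ) ≡ 2 * μ
  length-pairBlock R μ = begin
    length (pairBlock R μ)                          ≡⟨ length-++ (replicate μ _) ⟩
    length (replicate μ e) + length (replicate μ f) ≡⟨ cong₂ _+_ (length-replicate μ) (length-replicate μ) ⟩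
    μ + μ                                           ≡⟨ cong (μ +_) (+-identityʳ μ) ⟨
    2 * μ                                           ∎
    where
    open ≡-Reasoning
    e = 1 ◂ const 0
    f = μ ◂ lastUnit R

  length-unitPairs : ∀ R (n : Fin (suc R) → ℕ) → (∀ i → NonZero (n i)) →
                     length (unitPairs R n) + 2 * n (fromℕ R) ≡ 2 * Dstar n
  length-unitPairs zero n nz =
    cong (2 *_) (trans (sym (suc[n∸1]≡n (n zero) {{nz zero}})) (cong suc (sym (+-identityʳ _))))
  length-unitPairs (suc R) n nz = begin
    length (pairBlock R μ ++ map (0 ◂_) P) + 2 * M ≡⟨ cong (_+ 2 * M) length-block++P ⟩
    2 * μ + length P + 2 * M                      ≡⟨ +-assoc (2 * μ) (length P) (2 * M) ⟩
    2 * μ + (length P + 2 * M)                    ≡⟨ cong (2 * μ +_) (length-unitPairs R (n ∘ suc) (nz ∘ suc)) ⟩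
    2 * μ + 2 * Dstar (n ∘ suc)                   ≡⟨ *-distribˡ-+ 2 μ _ ⟨
    2 * (μ + Dstar (n ∘ suc))                     ≡⟨ cong (2 *_) (Dstar-suc n) ⟨
    2 * Dstar n                                   ∎
    where
    open ≡-Reasoning
    μ = n zero ∸ 1
    M = n (fromℕ (suc R))
    P = unitPairs R (n ∘ suc)
    length-block++P : length (pairBlock R μ ++ map (0 ◂_) P) ≡ 2 * μ + length P
    length-block++P = trans (length-++ (pairBlock R μ)) (cong₂ _+_ (length-pairBlock R μ) (length-map _ P))

  extremalVectors : ∀ R → (Fin (suc R) → ℕ) → ℕ → List (Vector ℕ (suc R))
  extremalVectors R n m = replicate (2 * n (fromℕ R) ∸ suc m) (lastUnit R) ++ unitPairs R n

  extremalSeq : ∀ R (n : Fin (suc R) → ℕ) → (∀ i → NonZero (n i)) → ℕ → Seq n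
  extremalSeq R n nz m = map (reduce n nz) (extremalVectors R n m)

  length-extremalSeq : ∀ R (n : Fin (suc R) → ℕ) nz m → suc m ≤ 2 * n (fromℕ R) →
                       length (extremalSeq R n nz m) + suc m ≡ 2 * Dstar n
  length-extremalSeq R n nz m m<2M = begin
    length (extremalSeq R n nz m) + suc m ≡⟨ cong (_+ suc m) (length-map _ (extremalVectors R n m)) ⟩
    length (Lₐ ++ P) + suc m              ≡⟨ cong (_+ suc m) (length-++ Lₐ) ⟩
    length Lₐ + length P + suc m          ≡⟨ cong (λ l → l + length P + suc m) (length-replicate a) ⟩
    a + length P + suc m                  ≡⟨ rearrange a (length P) (suc m) ⟩
    length P + (a + suc m)                ≡⟨ cong (length P +_) (m∸n+n≡m m<2M) ⟩
    length P + 2 * n (fromℕ R)            ≡⟨ length-unitPairs R n nz ⟩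
    2 * Dstar n                           ∎
    where
    open ≡-Reasoning
    a = 2 * n (fromℕ R) ∸ suc m
    Lₐ = replicate a (lastUnit R)
    P = unitPairs R n
    rearrange : ∀ x y z → x + y + z ≡ y + (x + z)
    rearrange = solve-∀

  extremalSeq-¬HasShortZS : ∀ R (n : Fin (suc R) → ℕ) nz m → suc m ≤ 2 * n (fromℕ R) →
                            ¬ HasShortZS n m (extremalSeq R n nz m)
  extremalSeq-¬HasShortZS R n nz m m<2M (T , T⊆ , T≢[] , |T|≤m , zsT)
    with ⊆-map⁻ (reduce n nz) (extremalVectors R n m) T⊆
  ... | U , U⊆ , refl with ⊆-++⁻ (replicate (2 * n (fromℕ R) ∸ suc m) (lastUnit R)) U⊆
  ... | V , W , V⊆ , W⊆ , refl with ⊆-replicate⁻ (2 * n (fromℕ R) ∸ suc m) V⊆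
  ... | b , b≤a , refl = <⇒≱ m<|T| |T|≤m
    where
    M = n (fromℕ R)
    a = 2 * M ∸ suc m
    U′ = replicate b (lastUnit R) ++ W
    F = coordSum W (fromℕ R)
    ∣cs : ∀ i → n i ∣ coordSum U′ i
    ∣cs = ZeroSum-reduce⇒∣coordSum n nz U′ zsT
    cs : ∀ i → coordSum U′ i ≡ b * lastUnit R i + coordSum W i
    cs i = trans (coordSum-++ (replicate b (lastUnit R)) W i)
                 (cong (_+ coordSum W i) (coordSum-replicate b (lastUnit R) i))
    cs-inner : ∀ j → coordSum U′ (inject₁ j) ≡ coordSum W (inject₁ j)
    cs-inner j = trans (cs (inject₁ j))
      (cong (_+ coordSum W (inject₁ j)) (trans (cong (b *_) (lastUnit-inject₁ R j)) (*-zeroʳ b)))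
    cs-last : coordSum U′ (fromℕ R) ≡ b + F
    cs-last = trans (cs (fromℕ R)) (cong (_+ F) (trans (cong (b *_) (lastUnit-fromℕ R)) (*-identityʳ b)))
    |W| : length W ≡ 2 * F
    |W| = ⊆unitPairs-balanced R n nz W⊆ λ j → subst (n (inject₁ j) ∣_) (cs-inner j) (∣cs (inject₁ j))
    |T| : length (map (reduce n nz) U′) ≡ b + 2 * F
    |T| = begin
      length (map (reduce n nz) U′)                ≡⟨ length-map _ U′ ⟩
      length U′                                    ≡⟨ length-++ (replicate b (lastUnit R)) ⟩
      length (replicate b (lastUnit R)) + length W ≡⟨ cong₂ _+_ (length-replicate b) |W| ⟩
      b + 2 * F                                    ∎
      where open ≡-Reasoning
    b+F≢0 : ¬ b + F ≡ 0
    b+F≢0 b+F≡0 = <⇒≢ (≢[]⇒0<length T≢[])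
      (sym (trans |T| (cong₂ (λ x y → x + 2 * y) (m+n≡0⇒m≡0 b b+F≡0) (m+n≡0⇒n≡0 b b+F≡0))))
    M≤b+F : M ≤ b + F
    M≤b+F = ∣⇒≤ {{≢-nonZero b+F≢0}} (subst (M ∣_) cs-last (∣cs (fromℕ R)))
    m<|T| : m < length (map (reduce n nz) U′)
    m<|T| = +-cancelˡ-≤ a (suc m) _ (begin
      a + suc m                         ≡⟨ m∸n+n≡m m<2M ⟩
      2 * M                             ≤⟨ *-monoʳ-≤ 2 M≤b+F ⟩
      2 * (b + F)                       ≡⟨ regroup b F ⟩
      b + (b + 2 * F)                   ≤⟨ +-monoˡ-≤ _ b≤a ⟩
      a + (b + 2 * F)                   ≡⟨ cong (a +_) |T| ⟨
      a + length (map (reduce n nz) U′) ∎)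
      where
      open ≤-Reasoning
      regroup : ∀ x y → 2 * (x + y) ≡ x + (x + 2 * y)
      regroup = solve-∀

  HasShortZS-⊆ : ∀ {n : Fin r → ℕ} {m S S′} → S ⊆ S′ → HasShortZS n m S → HasShortZS n m S′
  HasShortZS-⊆ S⊆S′ (T , T⊆S , short) = T , ⊆-trans T⊆S S⊆S′ , short

  SProp⇒HasShortZS : ∀ {n : Fin r → ℕ} {m ℓ} S → SProp n m ℓ → ℓ ≤ length S → HasShortZS n m S
  SProp⇒HasShortZS {ℓ = ℓ} S sp ℓ≤|S| =
    HasShortZS-⊆ (take-⊆ ℓ S) (sp (take ℓ S) (trans (length-take ℓ S) (m≤n⇒m⊓n≡m ℓ≤|S|)))

  ¬HasShortZS⇒s≤-atLeast : ∀ {n : Fin r → ℕ} {m} S → ¬ HasShortZS n m S →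
                           s≤-atLeast n m (suc (length S))
  ¬HasShortZS⇒s≤-atLeast S ¬short ℓ sp = ≰⇒> (¬short ∘ SProp⇒HasShortZS S sp)

  s≤-atLeast-2Dstar∸ : ∀ R (n : Fin (suc R) → ℕ) → (∀ i → NonZero (n i)) →
                       ∀ m → suc m ≤ 2 * n (fromℕ R) →
                       ∃ λ N → N + m ≡ 2 * Dstar n × s≤-atLeast n m N
  s≤-atLeast-2Dstar∸ R n nz m m<2M =
    suc (length S) ,
    trans (sym (+-suc (length S) m)) (length-extremalSeq R n nz m m<2M) ,
    ¬HasShortZS⇒s≤-atLeast S (extremalSeq-¬HasShortZS R n nz m m<2M)
    where S = extremalSeq R n nz m

open import Data.Nat using (ℕ; suc; _<_; _≤_)
open import Data.Nat.Divisibility using (_∣_)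
open import Data.Fin using (Fin; toℕ; fromℕ)
open import Data.Integer using (ℤ; +_; _+_; _-_; ∣_∣)
import Data.Integer as ℤ

import Data.Nat as ℕ
open import Data.Nat using (z≤n; z<s; >-nonZero)
open import Data.Nat.Properties using (<-trans)
open import Data.Integer.Properties
  using (0≤i⇒+∣i∣≡i; ≤-trans; ≤-reflexive; +-comm; i≤pred[j]⇒i<j; drop‿+<+; pos-+; pos-*)
open import Data.Integer.Tactic.RingSolver using (solve-∀)
open import Data.Product using (_,_)
open import Relation.Binary.PropositionalEquality

i≤j-1⇒i<j : ∀ {i j : ℤ} → i ℤ.≤ j - + 1 → i ℤ.< j
i≤j-1⇒i<j {j = j} i≤j-1 = i≤pred[j]⇒i<j (≤-trans i≤j-1 (≤-reflexive (+-comm j ℤ.-1ℤ)))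

∣D+k∣≡N : ∀ D N m (k : ℤ) → + m ≡ + D - k → N ℕ.+ m ≡ 2 ℕ.* D → ∣ + D + k ∣ ≡ N
∣D+k∣≡N D N m k +m≡D-k N+m≡2D = cong ∣_∣ (begin
  + D + k                 ≡⟨ reflect (+ D) k ⟩
  + 2 ℤ.* + D - (+ D - k) ≡⟨ cong₂ _-_ (pos-* 2 D) +m≡D-k ⟨
  + (2 ℕ.* D) - + m       ≡⟨ cong (λ x → + x - + m) N+m≡2D ⟨
  + (N ℕ.+ m) - + m       ≡⟨ cong (_- + m) (pos-+ N m) ⟩
  + N + + m - + m         ≡⟨ cancel (+ N) (+ m) ⟩
  + N                     ∎)
  where
  open ≡-Reasoning
  reflect : ∀ d k → d + k ≡ + 2 ℤ.* d - (d - k)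
  reflect = solve-∀
  cancel : ∀ x y → x + y - y ≡ x
  cancel = solve-∀

mainTheorem2 : (r : ℕ) → (n : Fin (suc r) → ℕ)
    → 1 ≤ r
    → ((i : Fin (suc r)) → 1 < n i)
    → ((i j : Fin (suc r)) → toℕ i ≤ toℕ j → n i ∣ n j)
    → (k : ℤ)
    → (+ n (fromℕ r)) ℤ.≤ (+ Dstar n) - k
    → (+ Dstar n) - k ℤ.≤ (+ (2 Data.Nat.* n (fromℕ r))) - (+ 1)
    → s≤-atLeast n ∣ (+ Dstar n) - k ∣ ∣ (+ Dstar n) + k ∣
mainTheorem2 r n _ 1<n _ k M≤D-k D-k≤2M-1 =
  let (N , N+m≡2D , bound) = s≤-atLeast-2Dstar∸ r n nz m m<2M
  in subst (s≤-atLeast n m) (sym (∣D+k∣≡N (Dstar n) N m k +m≡D-k N+m≡2D)) bound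
  where
  nz : ∀ i → ℕ.NonZero (n i)
  nz i = >-nonZero (<-trans z<s (1<n i))
  m = ∣ + Dstar n - k ∣
  +m≡D-k : + m ≡ + Dstar n - k
  +m≡D-k = 0≤i⇒+∣i∣≡i (≤-trans (ℤ.+≤+ z≤n) M≤D-k)
  m<2M : suc m ≤ 2 ℕ.* n (fromℕ r)
  m<2M = drop‿+<+ (i≤j-1⇒i<j (≤-trans (≤-reflexive +m≡D-k) D-k≤2M-1))
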